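{- Let $G$ be (the game form of) a 3-terminal Hex position. Then $G\equiv\top$ (i.e. $G$ has the connects-both property: Black can guarantee connecting all three black terminals within the region with White moving first) if and only if $G\mathbin{+_j} H^{\mathrm{op}}_n\equiv\top$ for all $n\geq 0$, where the dual simpleswitches are $H^{\mathrm{op}}_0=a$, $H^{\mathrm{op}}_1=\{a\mid a,\{b\mid\bot\}\}$ and $H^{\mathrm{op}}_{n+1}=\{H^{\mathrm{op}}_n\mid a,b\}$ for $n\geq1$.
   Context: A 3-terminal region of a Hex board is a set of cells completely surrounded by black and white stones (or board edges of the corresponding color) such that the surrounding black part has exactly three connected components, the terminals $1,2,3$, alternating with three white components; a 3-terminal Hex position is such a region with some cells possibly occupied. Outcome poset $P_3=\{\bot,a,b,c,\top\}$, $\bot<a,b,c<\top$, $a,b,c$ incomparable: in a full region the outcome is $\top$ if Black's stones connect all three terminals, $a$ if exactly $2,3$ are connected, $b$ if exactly $1,3$, $c$ if exactly $1,2$, $\bot$ if none. The game form of a position is atomic (its outcome) if the region is full, and otherwise $\{L\mid R\}$ where $L$ (resp. $R$) consists of the game forms after Black (resp. White) places a stone on an empty cell of the region. Game forms over a poset $A$: atomic $[x]$ (written $x$), $x\in A$, and composite $\{L\mid R\}$ with $L,R$ nonempty sets of game forms; atomic games have no options. $G^{(L)}$ is a left option if $G$ is composite and $G$ itself if atomic; similarly $G^{(R)}$. Mutually recursively: $G\leq H$ iff every $G^{(L)}\lhd H$ and $G\lhd H^{(R)}$ for every $H^{(R)}$; $G\lhd H$ iff some $G^R\leq H$, or $G\leq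 H^L$ for some $H^L$, or both are atomic $[x],[y]$ with $x\leq y$. $G\equiv H$ iff $G\leq H$ and $H\leq G$. Sum: for monotone $f:A\times B\to C$, $G+_fH=\{G^L+_fH,\,G+_fH^L\mid G^R+_fH,\,G+_fH^R\}$ if one of $G,H$ is composite, and $[x]+_f[y]=[f(x,y)]$. Juxtaposition $+_j$ is the sum with $f:P_3\times P_3\to\{\bot<\top\}$, where outcomes are viewed as equivalence relations on terminals ($\bot$ identity, $a$ identifies exactly $2,3$, $b$ exactly $1,3$, $c$ exactly $1,2$, $\top$ all): for $x$ on terminals $1_G,2_G,3_G$ and $y$ on $1_H,2_H,3_H$, take the equivalence generated by $x$, $y$, $1_G\sim 1_H$, $2_G\sim2_H$; $f(x,y)=\top$ iff $3_G\sim 3_H$, else $\bot$. -}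

module Defs where

open import Data.Nat using (ℕ; zero; suc)
open import Data.Integer using (ℤ; +_; -[1+_]) renaming (_+_ to _+ℤ_)
open import Data.Product using (Σ; ∃; _×_; _,_; proj₁; proj₂)
open import Data.Sum using (_⊎_)
open import Data.Fin using (Fin)
open import Data.Bool using (Bool; true; false; _∨_; if_then_else_)
open import Data.Maybe using (Maybe; just; nothing)
open import Data.List using (List; []; _∷_; map)
open import Data.Bool.ListAction using (any)
open import Data.List.NonEmpty using (List⁺; _∷_; toList; [_]) renaming (_⁺++⁺_ to _++⁺_)
open import Data.List.Membership.Propositional using (_∈_; _∉_)
open import Data.List.Relation.Unary.All using (All)
open import Data.List.Relation.Unary.Unique.Propositional using (Unique)
open import Data.List.Relation.Binary.Pointwise using (Pointwise)
open import Relation.Binary.PropositionalEquality using (_≡_; _≢_)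
open import Relation.Nullary using (¬_)

-- Game forms over a set of atoms A.
-- The (nonempty) sets of options are represented by nonempty lists;
-- only membership in these lists is ever used.

data Game (A : Set) : Set where
  atom : A → Game A
  node : List⁺ (Game A) → List⁺ (Game A) → Game A

module Order {A : Set} (_≼_ : A → A → Set) where

  LOpt : Game A → Game A → Set
  LOpt (atom x)   X = X ≡ atom x
  LOpt (node L R) X = X ∈ toList L

  ROpt : Game A → Game A → Set
  ROpt (atom x)   Y = Y ≡ atom x
  ROpt (node L R) Y = Y ∈ toList R

  infix 4 _≤G_ _◁_ _≡G_

  data _≤G_ (G H : Game A) : Set
  data _◁_ : Game A → Game A → Set

  data _≤G_ G H where
    le : (∀ X → LOpt G X → X ◁ H) → (∀ Y → ROpt H Y → G ◁ Y) → G ≤G H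

  data _◁_ where
    viaR  : ∀ {L R H Y} → Y ∈ toList R → Y ≤G H → node L R ◁ H
    viaL  : ∀ {G L R Y} → Y ∈ toList L → G ≤G Y → G ◁ node L R
    atoms : ∀ {x y} → x ≼ y → atom x ◁ atom y

  _≡G_ : Game A → Game A → Set
  G ≡G H = (G ≤G H) × (H ≤G G)

module Sum {A B C : Set} (f : A → B → C) where

  sum : Game A → Game B → Game C
  mapG  : List⁺ (Game A) → Game B → List⁺ (Game C)
  mapGl : List (Game A) → Game B → List (Game C)
  mapH  : Game A → List⁺ (Game B) → List⁺ (Game C)
  mapHl : Game A → List (Game B) → List (Game C)

  sum (atom x) (atom y) = atom (f x y)
  sum (atom x) (node L R) = node (mapH (atom x) L) (mapH (atom x) R)
  sum (node L R) (atom y) = node (mapG L (atom y)) (mapG R (atom y))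
  sum (node L R) (node L' R') =
    node (mapG L (node L' R') ++⁺ mapH (node L R) L')
         (mapG R (node L' R') ++⁺ mapH (node L R) R')

  mapG (g ∷ gs) h = sum g h ∷ mapGl gs h
  mapGl []       h = []
  mapGl (g ∷ gs) h = sum g h ∷ mapGl gs h
  mapH g (h ∷ hs) = sum g h ∷ mapHl g hs
  mapHl g []       = []
  mapHl g (h ∷ hs) = sum g h ∷ mapHl g hs

data P3 : Set where
  ⊥ a b c ⊤ : P3

data _≤P3_ : P3 → P3 → Set where
  ⊥≤ : ∀ {x} → ⊥ ≤P3 x
  ≤⊤ : ∀ {x} → x ≤P3 ⊤
  refl≤ : ∀ {x} → x ≤P3 x

data Two : Set where
  bot top : Two

data _≤2_ : Two → Two → Set where
  bot≤ : ∀ {x} → bot ≤2 x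
  ≤top : ∀ {x} → x ≤2 top
  refl≤2 : ∀ {x} → x ≤2 x

-- Juxtaposition: the monotone map f : P3 × P3 → Two.
-- Nodes: terminals 1_G,2_G,3_G,1_H,2_H,3_H.

data Node : Set where
  g1 g2 g3 h1 h2 h3 : Node

_==_ : Node → Node → Bool
g1 == g1 = true
g2 == g2 = true
g3 == g3 = true
h1 == h1 = true
h2 == h2 = true
h3 == h3 = true
_  == _  = false

-- generating pairs of the equivalence relation given by an outcome
-- on terminals t1,t2,t3
edgesOf : P3 → Node → Node → Node → List (Node × Node)
edgesOf ⊥ t1 t2 t3 = []
edgesOf a t1 t2 t3 = (t2 , t3) ∷ []
edgesOf b t1 t2 t3 = (t1 , t3) ∷ []
edgesOf c t1 t2 t3 = (t1 , t2) ∷ []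
edgesOf ⊤ t1 t2 t3 = (t1 , t2) ∷ (t2 , t3) ∷ []

juxEdges : P3 → P3 → List (Node × Node)
juxEdges x y = edgesOf x g1 g2 g3 Data.List.++ edgesOf y h1 h2 h3
               Data.List.++ ((g1 , h1) ∷ (g2 , h2) ∷ [])

stepSet : List (Node × Node) → (Node → Bool) → (Node → Bool)
stepSet es S n = S n ∨ any (λ e → (S (proj₁ e) ∧' (proj₂ e == n)) ∨ (S (proj₂ e) ∧' (proj₁ e == n))) es
  where
  _∧'_ : Bool → Bool → Bool
  true ∧' y = y
  false ∧' y = false

iterate : ℕ → ((Node → Bool) → (Node → Bool)) → (Node → Bool) → (Node → Bool)
iterate zero    F S = S
iterate (suc k) F S = iterate k F (F S)

-- equivalence class of a node in the equivalence generated by es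
-- (6 closure steps suffice for 6 nodes)
classOf : List (Node × Node) → Node → (Node → Bool)
classOf es n = iterate 6 (stepSet es) (n ==_)

jux : P3 → P3 → Two
jux x y = if classOf (juxEdges x y) g3 h3 then top else bot

_+j_ : Game P3 → Game P3 → Game Two
G +j H = Sum.sum jux G H

Hop : ℕ → Game P3
Hop zero = atom a
Hop (suc zero) = node [ atom a ] (atom a ∷ node [ atom b ] [ atom ⊥ ] ∷ [])
Hop (suc (suc n)) = node [ Hop (suc n) ] (atom a ∷ atom b ∷ [])

-- Hex geometry: the hexagonal grid in axial coordinates ℤ × ℤ.

Cell : Set
Cell = ℤ × ℤ

data Dir : Set where
  d1 d2 d3 d4 d5 d6 : Dir

offset : Dir → ℤ × ℤ
offset d1 = (+ 1 , + 0)
offset d2 = (-[1+ 0 ] , + 0)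
offset d3 = (+ 0 , + 1)
offset d4 = (+ 0 , -[1+ 0 ])
offset d5 = (+ 1 , -[1+ 0 ])
offset d6 = (-[1+ 0 ] , + 1)

step : Dir → Cell → Cell
step d (x , y) = (x +ℤ proj₁ (offset d) , y +ℤ proj₂ (offset d))

Adj : Cell → Cell → Set
Adj p q = Σ Dir (λ d → q ≡ step d p)

data Walk (P : Cell → Set) : Cell → Cell → Set where
  here  : ∀ {p} → P p → Walk P p p
  there : ∀ {p q r} → P p → Adj p q → Walk P q r → Walk P p r

-- labels of surrounding (boundary) cells:
-- black terminal i, or white component k
data BLab : Set where
  term : Fin 3 → BLab
  wall : Fin 3 → BLab

Labelled : (Cell → Maybe BLab) → BLab → Cell → Set
Labelled lab l q = lab q ≡ just l

record IsRegion (cells : List Cell) (lab : Cell → Maybe BLab) : Set where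
  field
    unique       : Unique cells
    outside      : ∀ q l → lab q ≡ just l → q ∉ cells
    touches      : ∀ q l → lab q ≡ just l → Σ Cell (λ p → p ∈ cells × Adj p q)
    surrounded   : ∀ p q → p ∈ cells → Adj p q → q ∉ cells → Σ BLab (λ l → lab q ≡ just l)
    nonempty     : ∀ l → Σ Cell (Labelled lab l)
    connected    : ∀ l p q → Labelled lab l p → Labelled lab l q → Walk (Labelled lab l) p q
    -- ... and distinct classes of the same colour are not adjacent, so the
    -- black part has exactly three components (the terminals) and the
    -- white part exactly three components
    termsApart   : ∀ i j p q → i ≢ j → Labelled lab (term i) p → Labelled lab (term j) q → ¬ Adj p q
    wallsApart   : ∀ i j p q → i ≢ j → Labelled lab (wall i) p → Labelled lab (wall j) q → ¬ Adj p q
    -- alternation: white component k lies between the terminals other than k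
    alternating  : ∀ k i → k ≢ i → Σ Cell (λ p → Σ Cell (λ q →
                     Labelled lab (wall k) p × Labelled lab (term i) q × Adj p q))

data St : Set where
  empty black white : St

Config : Set
Config = List (Cell × St)

cellsOf : Config → List Cell
cellsOf = map proj₁

Full : Config → Set
Full cfg = All (λ e → proj₂ e ≢ empty) cfg

moves : St → Config → List Config
moves s [] = []
moves s ((q , empty) ∷ xs) = ((q , s) ∷ xs) ∷ map ((q , empty) ∷_) (moves s xs)
moves s (e ∷ xs) = map (e ∷_) (moves s xs)

module Outcomes (lab : Cell → Maybe BLab) (cfg : Config) where

  BlackCell : Cell → Set
  BlackCell q = ((q , black) ∈ cfg) ⊎ Σ (Fin 3) (λ i → Labelled lab (term i) q)

  Conn : Fin 3 → Fin 3 → Set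
  Conn i j = Σ Cell (λ p → Σ Cell (λ q →
               Labelled lab (term i) p × Labelled lab (term j) q × Walk BlackCell p q))

  open import Data.Fin using (zero; suc)
  t1 t2 t3 : Fin 3
  t1 = zero
  t2 = suc zero
  t3 = suc (suc zero)

  Outcome : P3 → Set
  Outcome ⊤ = Conn t1 t2 × Conn t1 t3 × Conn t2 t3
  Outcome a = Conn t2 t3 × ¬ Conn t1 t2 × ¬ Conn t1 t3
  Outcome b = Conn t1 t3 × ¬ Conn t1 t2 × ¬ Conn t2 t3
  Outcome c = Conn t1 t2 × ¬ Conn t1 t3 × ¬ Conn t2 t3
  Outcome ⊥ = ¬ Conn t1 t2 × ¬ Conn t1 t3 × ¬ Conn t2 t3

data IsGameForm (lab : Cell → Maybe BLab) : Config → Game P3 → Set where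
  full : ∀ {cfg x} → Full cfg → Outcomes.Outcome lab cfg x → IsGameForm lab cfg (atom x)
  comp : ∀ {cfg L R} →
         Pointwise (IsGameForm lab) (moves black cfg) (toList L) →
         Pointwise (IsGameForm lab) (moves white cfg) (toList R) →
         IsGameForm lab cfg (node L R)

open Order _≤P3_ public using () renaming (_≡G_ to _≡P3_)
open Order _≤2_ public using () renaming (_≡G_ to _≡2_)

{-# OPTIONS --safe #-}

-- As long as n ≥ 2, White can at any moment replace Hop n by a or by b, while Black's moves in
-- Hop n only lower n, i.e. act as passes.  If n is at least 2 plus the number of empty cells of
-- G, Black cannot exhaust these passes before G is full, and White then picks whichever of a, b
-- the outcome of G does not dominate.  So Black's win in G +j Hop n is a win of ⊤ in G with
-- finitely many passes allowed to Black.  A pass never helps, because replacing a white stone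
-- by an empty cell or by a black stone does not hurt Black.

module Submission where

open import Defs
open import Data.Nat using (ℕ; zero; suc; _≤_; _<_; s≤s)
open import Data.Nat.Properties using (≤-refl; ≤-pred; <⇒≤; <-≤-trans)
open import Data.Nat.Induction using (<-wellFounded)
open import Induction.WellFounded using (Acc; acc)
open import Data.Product using (∃-syntax; _×_; _,_; proj₂)
open import Data.Sum using (_⊎_; inj₁; inj₂; [_,_]′)
open import Data.List using (List; []; _∷_; map; _++_)
open import Data.List.Properties using (++-identityʳ)
open import Data.List.NonEmpty using (_∷_; toList)
open import Data.List.Membership.Propositional using (_∈_)
open import Data.List.Membership.Propositional.Properties using (∈-++⁻; ∈-++⁺ˡ; ∈-++⁺ʳ; ∈-map⁻; ∈-map⁺)
open import Data.List.Relation.Unary.Any using (here; there)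
open import Data.List.Relation.Unary.All using (_∷_)
open import Data.List.Relation.Binary.Pointwise using (Pointwise; []; _∷_)
import Data.List.Relation.Binary.Pointwise as Pointwise
open import Data.Maybe using (Maybe)
open import Function using (id; flip)
open import Relation.Binary.PropositionalEquality using (_≡_; _≢_; refl; sym; trans; cong; cong₂; subst)
open import Relation.Nullary using (¬_; contradiction)

-- Options; unlike LOpt and ROpt, atomic games have none

lefts rights : {A : Set} → Game A → List (Game A)
lefts (atom _) = []
lefts (node L R) = toList L
rights (atom _) = []
rights (node L R) = toList R

-- Comparing a game with an atom

module _ {A : Set} (_≼_ : A → A → Set) where
  open Order _≼_

  ≤G⇒◁ : ∀ {x G} → atom x ≤G G → atom x ◁ G
  ≤G⇒◁ (le left _) = left _ refl

  rights⇒ROpt : ∀ {Y} G → Y ∈ rights G → ROpt G Y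
  rights⇒ROpt (node L R) Y∈ = Y∈

  ≤G⇒◁right : ∀ {x G Y} → atom x ≤G G → Y ∈ rights G → atom x ◁ Y
  ≤G⇒◁right {G = G} (le _ right) Y∈ = right _ (rights⇒ROpt G Y∈)

  -- An atom is its own left and right option, so `atom x ◁ G` settles the left clause and, for
  -- atomic `G`, the right one too. Only genuine right options remain.
  atom≤G : ∀ {x} G → atom x ◁ G → (∀ {Y} → Y ∈ rights G → atom x ◁ Y) → atom x ≤G G
  atom≤G (atom y) x◁G _ = le (λ { _ refl → x◁G }) (λ { _ refl → x◁G })
  atom≤G (node L R) x◁G x◁right = le (λ { _ refl → x◁G }) (λ _ → x◁right)

  ≤G-atom : ∀ {y G} → (∀ X → LOpt G X → X ◁ atom y) → G ◁ atom y → G ≤G atom y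
  ≤G-atom left◁y G◁y = le left◁y (λ { _ refl → G◁y })

  viaLefts : ∀ {X Y} G → Y ∈ lefts G → X ≤G Y → X ◁ G
  viaLefts (node L R) = viaL

  atom◁⁻ : ∀ {x G} → atom x ◁ G →
           (∃[ Y ] (Y ∈ lefts G × atom x ≤G Y)) ⊎ (∃[ y ] (G ≡ atom y × x ≼ y))
  atom◁⁻ (viaL Y∈ x≤Y) = inj₁ (_ , Y∈ , x≤Y)
  atom◁⁻ (atoms x≼y) = inj₂ (_ , refl , x≼y)

  atoms⁻ : ∀ {x y} → atom x ◁ atom y → x ≼ y
  atoms⁻ (atoms x≼y) = x≼y

  module _ {m : A} (≼m : ∀ x → x ≼ m) where

    -- Option lists are nonempty, so the first right option already witnesses `G ◁ atom m`. The list
    -- helpers keep the recursion structural.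
    ≤G-max : ∀ G → G ≤G atom m
    ◁-max  : ∀ G → G ◁ atom m
    all⁺◁-max : ∀ Gs X → X ∈ toList Gs → X ◁ atom m
    all◁-max  : ∀ Gs X → X ∈ Gs → X ◁ atom m
    any⁺≤G-max : ∀ Gs → ∃[ Y ] (Y ∈ toList Gs × Y ≤G atom m)

    ≤G-max (atom x) = le (λ { _ refl → ◁-max (atom x) }) (λ { _ refl → ◁-max (atom x) })
    ≤G-max G@(node L R) = ≤G-atom (all⁺◁-max L) (◁-max G)
    ◁-max (atom x) = atoms (≼m x)
    ◁-max (node L R) with _ , Y∈ , Y≤m ← any⁺≤G-max R = viaR Y∈ Y≤m
    all⁺◁-max (G ∷ Gs) _ (here refl) = ◁-max G
    all⁺◁-max (G ∷ Gs) X (there X∈) = all◁-max Gs X X∈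
    all◁-max (G ∷ Gs) _ (here refl) = ◁-max G
    all◁-max (G ∷ Gs) X (there X∈) = all◁-max Gs X X∈
    any⁺≤G-max (G ∷ _) = G , here refl , ≤G-max G

-- Options of a sum

module _ {A B C : Set} (f : A → B → C) where
  open Sum f

  mapGl≡map : ∀ Gs H → mapGl Gs H ≡ map (flip sum H) Gs
  mapGl≡map [] H = refl
  mapGl≡map (G ∷ Gs) H = cong (sum G H ∷_) (mapGl≡map Gs H)

  mapHl≡map : ∀ G Hs → mapHl G Hs ≡ map (sum G) Hs
  mapHl≡map G [] = refl
  mapHl≡map G (H ∷ Hs) = cong (sum G H ∷_) (mapHl≡map G Hs)

  toList-mapG : ∀ Gs H → toList (mapG Gs H) ≡ map (flip sum H) (toList Gs)
  toList-mapG (G ∷ Gs) H = cong (sum G H ∷_) (mapGl≡map Gs H)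

  toList-mapH : ∀ G Hs → toList (mapH G Hs) ≡ map (sum G) (toList Hs)
  toList-mapH G (H ∷ Hs) = cong (sum G H ∷_) (mapHl≡map G Hs)

  -- Because `lefts` of an atom is empty, one formula covers all four clauses of `sum`.
  lefts-sum : ∀ G H → lefts (sum G H) ≡ map (flip sum H) (lefts G) ++ map (sum G) (lefts H)
  lefts-sum (atom x) (atom y) = refl
  lefts-sum (atom x) (node L R) = toList-mapH (atom x) L
  lefts-sum (node L R) (atom y) = trans (toList-mapG L (atom y)) (sym (++-identityʳ _))
  -- Exposing the heads makes `toList` of the nonempty append reduce to `_++_`.
  lefts-sum G@(node L@(_ ∷ _) R) H@(node L'@(_ ∷ _) R') =
    cong₂ _++_ (toList-mapG L H) (toList-mapH G L')

  rights-sum : ∀ G H → rights (sum G H) ≡ map (flip sum H) (rights G) ++ map (sum G) (rights H)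
  rights-sum (atom x) (atom y) = refl
  rights-sum (atom x) (node L R) = toList-mapH (atom x) R
  rights-sum (node L R) (atom y) = trans (toList-mapG R (atom y)) (sym (++-identityʳ _))
  rights-sum G@(node L R@(_ ∷ _)) H@(node L' R'@(_ ∷ _)) =
    cong₂ _++_ (toList-mapG R H) (toList-mapH G R')

  left-sumˡ : ∀ {X} G H → X ∈ lefts G → sum X H ∈ lefts (sum G H)
  left-sumˡ G H X∈ = subst (_ ∈_) (sym (lefts-sum G H)) (∈-++⁺ˡ (∈-map⁺ (flip sum H) X∈))

  left-sumʳ : ∀ {X} G H → X ∈ lefts H → sum G X ∈ lefts (sum G H)
  left-sumʳ G H X∈ = subst (_ ∈_) (sym (lefts-sum G H)) (∈-++⁺ʳ _ (∈-map⁺ (sum G) X∈))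

  right-sumˡ : ∀ {X} G H → X ∈ rights G → sum X H ∈ rights (sum G H)
  right-sumˡ G H X∈ = subst (_ ∈_) (sym (rights-sum G H)) (∈-++⁺ˡ (∈-map⁺ (flip sum H) X∈))

  right-sumʳ : ∀ {X} G H → X ∈ rights H → sum G X ∈ rights (sum G H)
  right-sumʳ G H X∈ = subst (_ ∈_) (sym (rights-sum G H)) (∈-++⁺ʳ _ (∈-map⁺ (sum G) X∈))

  ∈-sums⁻ : ∀ {G H Z} {Xs Ys} → Z ∈ map (flip sum H) Xs ++ map (sum G) Ys →
            (∃[ X ] (X ∈ Xs × Z ≡ sum X H)) ⊎ (∃[ Y ] (Y ∈ Ys × Z ≡ sum G Y))
  ∈-sums⁻ {G} {H} {Xs = Xs} Z∈ with ∈-++⁻ (map (flip sum H) Xs) Z∈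
  ... | inj₁ Z∈ˡ = inj₁ (∈-map⁻ (flip sum H) Z∈ˡ)
  ... | inj₂ Z∈ʳ = inj₂ (∈-map⁻ (sum G) Z∈ʳ)

  left-sum⁻ : ∀ {Z} G H → Z ∈ lefts (sum G H) →
              (∃[ X ] (X ∈ lefts G × Z ≡ sum X H)) ⊎ (∃[ Y ] (Y ∈ lefts H × Z ≡ sum G Y))
  left-sum⁻ G H Z∈ = ∈-sums⁻ {G} {H} (subst (_ ∈_) (lefts-sum G H) Z∈)

  right-sum⁻ : ∀ {Z} G H → Z ∈ rights (sum G H) →
               (∃[ X ] (X ∈ rights G × Z ≡ sum X H)) ⊎ (∃[ Y ] (Y ∈ rights H × Z ≡ sum G Y))
  right-sum⁻ G H Z∈ = ∈-sums⁻ {G} {H} (subst (_ ∈_) (rights-sum G H) Z∈)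

-- Replacing a maximal atom inside a sum

module _ {A B C : Set} (_≼_ : A → A → Set) (_≼′_ : C → C → Set) (f : A → B → C)
         {x : A} (x-maximal : ∀ {y} → x ≼ y → y ≡ x) where
  open Sum f
  private
    module A = Order _≼_
    module C = Order _≼′_

  -- Black answers White in the component where White moved: in `G` by the strategy for
  -- `atom x ≤G G`, in `H` by the one for `sum (atom x) H`. If play in `G` ends in an atom above
  -- `x`, maximality makes it `x`, and the two sums coincide.
  sum-mono-≤  : ∀ {z G H} → atom x A.≤G G → atom z C.≤G sum (atom x) H → atom z C.≤G sum G H
  sum-mono-◁  : ∀ {z G H} → atom x A.≤G G → atom z C.≤G sum (atom x) H → atom z C.◁ sum G H
  sum-mono-◁ˡ : ∀ {z G H} → atom x A.◁ G → atom z C.≤G sum (atom x) H → atom z C.◁ sum G H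
  sum-mono-◁ʳ : ∀ {z G H} → atom x A.≤G G → atom z C.◁ sum (atom x) H → atom z C.◁ sum G H
  sum-mono-rightˡ : ∀ {z G H Z} → atom x A.≤G G → atom z C.≤G sum (atom x) H →
                    (∃[ X ] (X ∈ rights G × Z ≡ sum X H)) → atom z C.◁ Z
  sum-mono-rightʳ : ∀ {z G H Z} → atom x A.≤G G → atom z C.≤G sum (atom x) H →
                    (∃[ Y ] (Y ∈ rights H × Z ≡ sum G Y)) → atom z C.◁ Z

  sum-mono-≤ {G = G} {H} x≤G z≤ =
    atom≤G _≼′_ (sum G H) (sum-mono-◁ x≤G z≤)
      λ Z∈ → [ sum-mono-rightˡ x≤G z≤ , sum-mono-rightʳ x≤G z≤ ]′ (right-sum⁻ f G H Z∈)

  sum-mono-◁ (A.le left _) z≤ = sum-mono-◁ˡ (left _ refl) z≤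

  sum-mono-rightˡ {G = G} (A.le _ right) z≤ (_ , X∈ , refl) =
    sum-mono-◁ˡ (right _ (rights⇒ROpt _≼_ G X∈)) z≤

  sum-mono-rightʳ {H = H} x≤G (C.le _ right) (_ , Y∈ , refl) =
    sum-mono-◁ʳ x≤G (right _ (rights⇒ROpt _≼′_ (sum (atom x) H) (right-sumʳ f (atom x) H Y∈)))

  sum-mono-◁ˡ {G = G@(node L R)} {H} (A.viaL X∈ x≤X) z≤ =
    viaLefts _≼′_ (sum G H) (left-sumˡ f G H X∈) (sum-mono-≤ x≤X z≤)
  sum-mono-◁ˡ (A.atoms x≼y) z≤ with refl ← x-maximal x≼y = ≤G⇒◁ _≼′_ z≤

  -- `sum (atom x) H` is now atomic, so `◁` upgrades to `≤`, and Black moves in `G` instead.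
  sum-mono-◁ʳ {H = atom y} x≤G z◁ =
    sum-mono-◁ x≤G (atom≤G _≼′_ (atom (f x y)) z◁ λ ())
  sum-mono-◁ʳ {G = G} {H@(node L R)} x≤G (C.viaL Z∈ z≤Z) with left-sum⁻ f (atom x) H Z∈
  -- `atom x` has no left options, so the winning move lies in `H`.
  ... | inj₂ (Y , Y∈ , refl) =
    viaLefts _≼′_ (sum G H) (left-sumʳ f G H Y∈) (sum-mono-≤ x≤G z≤Z)

-- Dual simpleswitches next to `⊤`

module P = Order _≤P3_
module T = Order _≤2_

⊤-max : ∀ {x} → ⊤ ≤P3 x → x ≡ ⊤
⊤-max ≤⊤ = refl
⊤-max refl≤ = refl

top≤atom-top : atom top T.≤G atom top
top≤atom-top = atom≤G _≤2_ _ (T.atoms refl≤2) λ ()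

-- `jux ⊤` is `top` at both `a` and `b`. The only bad atom is the `⊥` inside `Hop 1`, and when White
-- threatens it Black replies with `b`.
top≤⊤+jHop : ∀ n → atom top T.≤G (atom ⊤ +j Hop n)
top≤⊤+jHop zero = top≤atom-top
top≤⊤+jHop (suc zero) =
  atom≤G _≤2_ _ (T.viaL (here refl) top≤atom-top)
    λ { (here refl) → T.atoms refl≤2
      ; (there (here refl)) → T.viaL (here refl) top≤atom-top }
top≤⊤+jHop (suc (suc n)) =
  atom≤G _≤2_ _ (T.viaL (here refl) (top≤⊤+jHop (suc n)))
    λ { (here refl) → T.atoms refl≤2
      ; (there (here refl)) → T.atoms refl≤2 }

-- Placing stones

data Placed (s : St) : Config → Config → Set where
  here  : ∀ {q cfg} → Placed s ((q , empty) ∷ cfg) ((q , s) ∷ cfg)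
  there : ∀ {e cfg cfg'} → Placed s cfg cfg' → Placed s (e ∷ cfg) (e ∷ cfg')

∈-moves⁺ : ∀ {s cfg cfg'} → Placed s cfg cfg' → cfg' ∈ moves s cfg
∈-moves⁺ here = here refl
∈-moves⁺ (there {_ , empty} p) = there (∈-map⁺ _ (∈-moves⁺ p))
∈-moves⁺ (there {_ , black} p) = ∈-map⁺ _ (∈-moves⁺ p)
∈-moves⁺ (there {_ , white} p) = ∈-map⁺ _ (∈-moves⁺ p)

∈-moves⁻ : ∀ {s} cfg {cfg'} → cfg' ∈ moves s cfg → Placed s cfg cfg'
∈-moves⁻ ((q , empty) ∷ cfg) (here refl) = here
∈-moves⁻ ((q , empty) ∷ cfg) (there m) with _ , m' , refl ← ∈-map⁻ _ m = there (∈-moves⁻ cfg m')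
∈-moves⁻ ((q , black) ∷ cfg) m with _ , m' , refl ← ∈-map⁻ _ m = there (∈-moves⁻ cfg m')
∈-moves⁻ ((q , white) ∷ cfg) m with _ , m' , refl ← ∈-map⁻ _ m = there (∈-moves⁻ cfg m')

Full⇒¬Placed : ∀ {s cfg cfg'} → Full cfg → ¬ Placed s cfg cfg'
Full⇒¬Placed (occupied ∷ _) here = occupied refl
Full⇒¬Placed (_ ∷ cfg-full) (there p) = Full⇒¬Placed cfg-full p

empties : Config → ℕ
empties [] = 0
empties ((_ , empty) ∷ cfg) = suc (empties cfg)
empties (_ ∷ cfg) = empties cfg

empties-Placed : ∀ {s cfg cfg'} → s ≢ empty → Placed s cfg cfg' → empties cfg' < empties cfg
empties-Placed {empty} s≢empty _ = contradiction refl s≢empty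
empties-Placed {black} _ here = ≤-refl
empties-Placed {white} _ here = ≤-refl
empties-Placed {black} ne (there {_ , empty} p) = s≤s (empties-Placed ne p)
empties-Placed {black} ne (there {_ , black} p) = empties-Placed ne p
empties-Placed {black} ne (there {_ , white} p) = empties-Placed ne p
empties-Placed {white} ne (there {_ , empty} p) = s≤s (empties-Placed ne p)
empties-Placed {white} ne (there {_ , black} p) = empties-Placed ne p
empties-Placed {white} ne (there {_ , white} p) = empties-Placed ne p

-- Comparing positions

-- The right side is at least as good for Black. Relating `empty` to `black` is excluded, so a cell
-- empty on the left is also empty on the right and moves can be copied from left to right.
data _⊑_ : Cell × St → Cell × St → Set where
  same   : ∀ {e} → e ⊑ e
  white⊑ : ∀ {q s} → (q , white) ⊑ (q , s)

_⊑*_ : Config → Config → Set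
_⊑*_ = Pointwise _⊑_

⊑*-refl : ∀ {cfg} → cfg ⊑* cfg
⊑*-refl = Pointwise.refl same

white-⊑* : ∀ {cfg cfg'} → Placed white cfg cfg' → cfg' ⊑* cfg
white-⊑* here = white⊑ ∷ ⊑*-refl
white-⊑* (there p) = same ∷ white-⊑* p

⊑*-Placedˡ : ∀ {s cfg₁ cfg₂ cfg₁'} → cfg₁ ⊑* cfg₂ → Placed s cfg₁ cfg₁' →
             ∃[ cfg₂' ] (Placed s cfg₂ cfg₂' × cfg₁' ⊑* cfg₂')
⊑*-Placedˡ (same ∷ es) here = _ , here , same ∷ es
⊑*-Placedˡ (e ∷ es) (there p) with _ , p' , es' ← ⊑*-Placedˡ es p = _ , there p' , e ∷ es'

-- The cell being filled is either empty on the left, where the move is mirrored, or white there,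
-- where any stone preserves the comparison.
⊑*-Placedʳ : ∀ {s cfg₁ cfg₂ cfg₂'} → cfg₁ ⊑* cfg₂ → Placed s cfg₂ cfg₂' →
             cfg₁ ⊑* cfg₂' ⊎ (∃[ cfg₁' ] (Placed s cfg₁ cfg₁' × cfg₁' ⊑* cfg₂'))
⊑*-Placedʳ (same ∷ es) here = inj₂ (_ , here , same ∷ es)
⊑*-Placedʳ (white⊑ ∷ es) here = inj₁ (white⊑ ∷ es)
⊑*-Placedʳ (e ∷ es) (there p) with ⊑*-Placedʳ es p
... | inj₁ es' = inj₁ (e ∷ es')
... | inj₂ (_ , p' , es') = inj₂ (_ , there p' , e ∷ es')

∈-black-mono : ∀ {cfg₁ cfg₂ q} → cfg₁ ⊑* cfg₂ → (q , black) ∈ cfg₁ → (q , black) ∈ cfg₂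
∈-black-mono (same ∷ _) (here refl) = here refl
∈-black-mono (_ ∷ es) (there q∈) = there (∈-black-mono es q∈)

Walk-map : ∀ {P Q : Cell → Set} → (∀ {q} → P q → Q q) → ∀ {p q} → Walk P p q → Walk Q p q
Walk-map f (here Pp) = here (f Pp)
Walk-map f (there Pp adj w) = there (f Pp) adj (Walk-map f w)

Pointwise-∈ˡ : ∀ {A B : Set} {R : A → B → Set} {xs ys x} → Pointwise R xs ys → x ∈ xs →
               ∃[ y ] (y ∈ ys × R x y)
Pointwise-∈ˡ (r ∷ _) (here refl) = _ , here refl , r
Pointwise-∈ˡ (_ ∷ rs) (there x∈) with y , y∈ , r ← Pointwise-∈ˡ rs x∈ = y , there y∈ , r

Pointwise-∈ʳ : ∀ {A B : Set} {R : A → B → Set} {xs ys y} → Pointwise R xs ys → y ∈ ys →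
               ∃[ x ] (x ∈ xs × R x y)
Pointwise-∈ʳ rs = Pointwise-∈ˡ (Pointwise.symmetric id rs)

-- Transfer of wins between positions

module _ (lab : Cell → Maybe BLab) where

  Conn-mono : ∀ {cfg₁ cfg₂ i j} → cfg₁ ⊑* cfg₂ →
              Outcomes.Conn lab cfg₁ i j → Outcomes.Conn lab cfg₂ i j
  Conn-mono es (p , q , lp , lq , w) =
    p , q , lp , lq , Walk-map (λ { (inj₁ q∈) → inj₁ (∈-black-mono es q∈) ; (inj₂ l) → inj₂ l }) w

  Outcome-⊤-mono : ∀ {cfg₁ cfg₂} x → cfg₁ ⊑* cfg₂ →
                   Outcomes.Outcome lab cfg₁ ⊤ → Outcomes.Outcome lab cfg₂ x → x ≡ ⊤
  Outcome-⊤-mono ⊤ es _ _ = refl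
  Outcome-⊤-mono a es (c12 , _) (_ , ¬c12 , _) = contradiction (Conn-mono es c12) ¬c12
  Outcome-⊤-mono b es (c12 , _) (_ , ¬c12 , _) = contradiction (Conn-mono es c12) ¬c12
  Outcome-⊤-mono c es (_ , c13 , _) (_ , ¬c13 , _) = contradiction (Conn-mono es c13) ¬c13
  Outcome-⊤-mono ⊥ es (c12 , _) (¬c12 , _) = contradiction (Conn-mono es c12) ¬c12

  left-move : ∀ {cfg G X} → IsGameForm lab cfg G → X ∈ lefts G →
              ∃[ cfg' ] (Placed black cfg cfg' × IsGameForm lab cfg' X)
  left-move {cfg} (comp ls rs) X∈ with cfg' , m , form ← Pointwise-∈ʳ ls X∈ =
    cfg' , ∈-moves⁻ cfg m , form

  right-move : ∀ {cfg G X} → IsGameForm lab cfg G → X ∈ rights G →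
               ∃[ cfg' ] (Placed white cfg cfg' × IsGameForm lab cfg' X)
  right-move {cfg} (comp ls rs) X∈ with cfg' , m , form ← Pointwise-∈ʳ rs X∈ =
    cfg' , ∈-moves⁻ cfg m , form

  move-left : ∀ {cfg cfg' G} → IsGameForm lab cfg G → Placed black cfg cfg' →
              ∃[ X ] (X ∈ lefts G × IsGameForm lab cfg' X)
  move-left (full cfg-full _) p = contradiction p (Full⇒¬Placed cfg-full)
  move-left (comp ls rs) p = Pointwise-∈ˡ ls (∈-moves⁺ p)

  move-right : ∀ {cfg cfg' G} → IsGameForm lab cfg G → Placed white cfg cfg' →
               ∃[ X ] (X ∈ rights G × IsGameForm lab cfg' X)
  move-right (full cfg-full _) p = contradiction p (Full⇒¬Placed cfg-full)
  move-right (comp ls rs) p = Pointwise-∈ˡ rs (∈-moves⁺ p)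

  -- Strategy copying: Black plays in `cfg₂` the moves that win in `cfg₁`. The induction counts
  -- empty cells of `cfg₂`, since `cfg₁` may stand still during a move.
  ⊤≤-mono : ∀ {cfg₁ cfg₂ G₁ G₂} → Acc _<_ (empties cfg₂) → cfg₁ ⊑* cfg₂ →
            IsGameForm lab cfg₁ G₁ → IsGameForm lab cfg₂ G₂ → atom ⊤ P.≤G G₁ → atom ⊤ P.≤G G₂
  ⊤◁-mono : ∀ {cfg₁ cfg₂ G₁ G₂} → Acc _<_ (empties cfg₂) → cfg₁ ⊑* cfg₂ →
            IsGameForm lab cfg₁ G₁ → IsGameForm lab cfg₂ G₂ → atom ⊤ P.◁ G₁ → atom ⊤ P.◁ G₂

  ⊤≤-mono {G₂ = G₂} wf@(acc rec) es form₁ form₂ ⊤≤G₁ =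
    atom≤G _≤P3_ G₂ (⊤◁-mono wf es form₁ form₂ (≤G⇒◁ _≤P3_ ⊤≤G₁)) ⊤◁right
    where
    ⊤◁right : ∀ {Y} → Y ∈ rights G₂ → atom ⊤ P.◁ Y
    ⊤◁right Y∈ with right-move form₂ Y∈
    ... | _ , p , formY with ⊑*-Placedʳ es p
    -- White used a cell already white in `cfg₁`. `G₁` is unchanged and Black is to move, which
    -- `⊤≤G₁` also covers.
    ... | inj₁ es' =
      ⊤◁-mono (rec (empties-Placed (λ ()) p)) es' form₁ formY (≤G⇒◁ _≤P3_ ⊤≤G₁)
    ... | inj₂ (_ , p₁ , es') with X , X∈ , formX ← move-right form₁ p₁ =
      ⊤◁-mono (rec (empties-Placed (λ ()) p)) es' formX formY (≤G⇒◁right _≤P3_ ⊤≤G₁ X∈)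

  ⊤◁-mono {G₂ = G₂} (acc rec) es form₁ form₂ ⊤◁G₁ with atom◁⁻ _≤P3_ ⊤◁G₁
  ... | inj₁ (X , X∈ , ⊤≤X)
    with _ , p₁ , formX ← left-move form₁ X∈
    with _ , p₂ , es' ← ⊑*-Placedˡ es p₁
    with Y , Y∈ , formY ← move-left form₂ p₂ =
    viaLefts _≤P3_ G₂ Y∈ (⊤≤-mono (rec (empties-Placed (λ ()) p₂)) es' formX formY ⊤≤X)
  ⊤◁-mono (acc rec) es (full full₁ out₁) (full {x = x} _ out₂) _ | inj₂ (_ , refl , ⊤≤)
    with refl ← ⊤-max ⊤≤
    with refl ← Outcome-⊤-mono x es out₁ out₂ = P.atoms refl≤
  -- `cfg₁` is full with outcome `⊤`, so every cell still empty in `cfg₂` is white in `cfg₁`, and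
  -- Black may fill any of them.
  ⊤◁-mono (acc rec) es form₁@(full full₁ _) form₂@(comp {L = _ ∷ _} _ _) ⊤◁G₁ | inj₂ (_ , refl , _)
    with _ , p , formX ← left-move form₂ (here refl)
    with ⊑*-Placedʳ es p
  ... | inj₁ es' =
    P.viaL (here refl) (⊤≤-mono (rec (empties-Placed (λ ()) p)) es' form₁ formX
                                 (atom≤G _≤P3_ _ ⊤◁G₁ λ ()))
  ... | inj₂ (_ , p₁ , _) = contradiction p₁ (Full⇒¬Placed full₁)

  -- f stands for jux, which would unfold to an enormous case tree on a variable outcome.
  module _ (f : P3 → P3 → Two) (f-a-b : ∀ x → top ≤2 f x a → top ≤2 f x b → x ≡ ⊤) where
    open Sum f

    -- The bound is weak with White to move and strict with Black to move. A stone of White in `G`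
    -- turns weak into strict, and the strictness pays for one pass of Black, which lowers `k`.
    sum-Hop-≤⁻ : ∀ {cfg G} k → Acc _<_ (empties cfg) → IsGameForm lab cfg G → empties cfg ≤ k →
                 atom top T.≤G sum G (Hop (suc (suc k))) → atom ⊤ P.≤G G
    sum-Hop-◁⁻ : ∀ {cfg G} k → Acc _<_ (empties cfg) → IsGameForm lab cfg G → empties cfg < k →
                 atom top T.◁ sum G (Hop (suc (suc k))) → atom ⊤ P.◁ G

    sum-Hop-≤⁻ k _ (full {x = x} _ _) _ top≤
      -- White may turn the switch into `a` or into `b`, and Black must win both times.
      with refl ← f-a-b x (atoms⁻ _≤2_ (≤G⇒◁right _≤2_ top≤ (here refl)))
                           (atoms⁻ _≤2_ (≤G⇒◁right _≤2_ top≤ (there (here refl)))) =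
      atom≤G _≤P3_ _ (P.atoms refl≤) λ ()
    sum-Hop-≤⁻ {cfg} {G@(node L R@(_ ∷ _))} k (acc rec) form@(comp _ _) e≤k top≤ =
      atom≤G _≤P3_ _ ⊤◁G ⊤◁right
      where
      ⊤◁right : ∀ {Y} → Y ∈ rights G → atom ⊤ P.◁ Y
      ⊤◁right Y∈ with _ , p , formY ← right-move form Y∈ =
        sum-Hop-◁⁻ k (rec e<) formY (<-≤-trans e< e≤k)
          (≤G⇒◁right _≤2_ top≤ (right-sumˡ f G (Hop (suc (suc k))) Y∈))
        where e< = empties-Placed (λ ()) p

      -- The weak bound does not let `sum-Hop-◁⁻` apply to `G` itself. Instead White plays first
      -- anywhere, Black wins moving next, and taking that white stone away does no harm.
      ⊤◁G : atom ⊤ P.◁ G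
      ⊤◁G with _ , p , formY ← right-move form (here refl) =
        ⊤◁-mono (acc rec) (white-⊑* p) formY form (⊤◁right (here refl))

    sum-Hop-◁⁻ {G = G} (suc k) wf@(acc rec) form e<k top◁ with atom◁⁻ _≤2_ top◁
    sum-Hop-◁⁻ {G = atom _} (suc k) _ _ _ _ | inj₂ (_ , () , _)
    sum-Hop-◁⁻ {G = node _ _} (suc k) _ _ _ _ | inj₂ (_ , () , _)
    ... | inj₁ (Z , Z∈ , top≤Z) with left-sum⁻ f G (Hop (suc (suc (suc k)))) Z∈
    ... | inj₁ (X , X∈ , refl) with _ , p , formX ← left-move form X∈ =
      viaLefts _≤P3_ G X∈
        (sum-Hop-≤⁻ (suc k) (rec e<) formX (<⇒≤ (<-≤-trans e< (<⇒≤ e<k))) top≤Z)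
      where e< = empties-Placed (λ ()) p
    -- The pass: the only left option of `Hop (suc (suc (suc k)))` is `Hop (suc (suc k))`.
    ... | inj₂ (_ , here refl , refl) = ≤G⇒◁ _≤P3_ (sum-Hop-≤⁻ k wf form (≤-pred e<k) top≤Z)

-- Against `a` the outcome `x` must connect terminals 2 and 3, against `b` terminals 1 and 3; only
-- `⊤` does both.
jux-a-b : ∀ x → top ≤2 jux x a → top ≤2 jux x b → x ≡ ⊤
jux-a-b ⊤ _ _ = refl
jux-a-b ⊥ () _
jux-a-b a _ ()
jux-a-b b () _
jux-a-b c () _

theorem4p7 : (lab : Cell → Maybe BLab) (cfg : Config) →
    IsRegion (cellsOf cfg) lab →
    (G : Game P3) → IsGameForm lab cfg G →
    ((G ≡P3 atom ⊤) → ((n : ℕ) → (G +j Hop n) ≡2 atom top))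
    × (((n : ℕ) → (G +j Hop n) ≡2 atom top) → (G ≡P3 atom ⊤))
theorem4p7 lab cfg _ G form =
    (λ (_ , ⊤≤G) n → ≤G-max _≤2_ (λ _ → ≤top) (G +j Hop n) ,
      sum-mono-≤ _≤P3_ _≤2_ jux ⊤-max ⊤≤G (top≤⊤+jHop n))
  , (λ +j≡top → ≤G-max _≤P3_ (λ _ → ≤⊤) G ,
      -- Here `k` is `empties cfg`, so the weak bound holds with equality.
      sum-Hop-≤⁻ lab jux jux-a-b (empties cfg) (<-wellFounded _) form ≤-refl
        (proj₂ (+j≡top (suc (suc (empties cfg))))))
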